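{- Let $a,b,c$ be distinct. The spherical tiling by $12$ edge congruent pentagons with edge lengths $a,a,b,b,c$ is, up to symmetries, given by the following assignment of lengths to the edges of the dodecahedral pattern: length $a$: $E_{1,3},E_{1,4},E_{3,4},\;E_{2,7},E_{2,11},E_{7,11},\;E_{5,6},E_{5,10},E_{6,10},\;E_{8,9},E_{8,12},E_{9,12}$; length $b$: $E_{1,2},E_{1,6},E_{2,6},\;E_{3,7},E_{3,8},E_{7,8},\;E_{4,5},E_{4,9},E_{5,9},\;E_{10,11},E_{10,12},E_{11,12}$; length $c$: $E_{1,5},E_{2,3},E_{4,8},E_{6,11},E_{7,12},E_{9,10}$.
   Context: A spherical tiling by $12$ pentagons (graph embedded in $S^2$ with all vertices of degree $\ge 3$, every tile a five-edged region enclosed by a simple closed curve; edges may be any nice curves) is combinatorially the dodecahedral pattern: tiles $P_1,\dots,P_{12}$, where $P_i$ with list $(n_1,\dots,n_5)$ has edges in cyclic order $E_{i,n_1},\dots,E_{i,n_5}$, $E_{i,j}=E_{j,i}$ being the common edge of $P_i$ and $P_j$, and (with $n_6=n_1$) $E_{i,n_k},E_{i,n_{k+1}}$ meet at the vertex $V_{i,n_k,n_{k+1}}$ of degree $3$ shared by $P_i,P_{n_k},P_{n_{k+1}}$: $P_1:(2,3,4,5,6)$; $P_2:(1,6,11,7,3)$; $P_3:(1,2,7,8,4)$; $P_4:(1,3,8,9,5)$; $P_5:(1,4,9,10,6)$; $P_6:(1,5,10,11,2)$; $P_7:(12,8,3,2,11)$; $P_8:(12,9,4,3,7)$; $P_9:(12,10,5,4,8)$;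 $P_{10}:(12,11,6,5,9)$; $P_{11}:(12,7,2,6,10)$; $P_{12}:(7,11,10,9,8)$. An edge congruent tiling is considered as an assignment of lengths to the $30$ edges such that all tiles are edge congruent, i.e. for any two tiles there is an adjacency-preserving correspondence of their edges that preserves lengths. No geometric realization by great arcs is required. "Up to symmetries" means up to symmetries of the dodecahedral pattern (including reflections) and of the letters $a,b$. -}

module Defs where

open import Data.Fin using (Fin; zero; suc; toℕ; _≟_)
open import Data.Fin.Permutation using (Permutation′; _⟨$⟩ʳ_)
open import Data.List using (List; []; _∷_)
open import Data.List.Relation.Binary.Permutation.Propositional using (_↭_)
open import Data.List.Relation.Unary.All using (All)
open import Data.Nat using (suc)
open import Data.Nat.DivMod using (_mod_)
open import Data.Product using (Σ-syntax; ∃₂; _×_; _,_)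
open import Data.Sum using (_⊎_)
open import Data.Vec using (Vec; []; _∷_; lookup; tabulate; toList)
open import Data.Vec.Membership.DecPropositional {A = Fin 12} _≟_ using (_∈?_)
open import Data.Vec.Membership.Propositional using (_∈_)
open import Data.Vec.Membership.Propositional.Properties using (∈-lookup)
open import Level using (Level)
open import Relation.Binary.PropositionalEquality using (_≡_)
open import Relation.Nullary.Decidable using (True; toWitness)

private
  variable
    ℓ : Level

Tile : Set
Tile = Fin 12

pattern P₁  = zero
pattern P₂  = suc P₁
pattern P₃  = suc P₂
pattern P₄  = suc P₃
pattern P₅  = suc P₄
pattern P₆  = suc P₅
pattern P₇  = suc P₆
pattern P₈  = suc P₇
pattern P₉  = suc P₈
pattern P₁₀ = suc P₉
pattern P₁₁ = suc P₁₀
pattern P₁₂ = suc P₁₁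

-- The neighbours of each tile, in the cyclic order of the shared edges.
boundary : Tile → Vec Tile 5
boundary P₁  = P₂ ∷ P₃ ∷ P₄ ∷ P₅ ∷ P₆ ∷ []
boundary P₂  = P₁ ∷ P₆ ∷ P₁₁ ∷ P₇ ∷ P₃ ∷ []
boundary P₃  = P₁ ∷ P₂ ∷ P₇ ∷ P₈ ∷ P₄ ∷ []
boundary P₄  = P₁ ∷ P₃ ∷ P₈ ∷ P₉ ∷ P₅ ∷ []
boundary P₅  = P₁ ∷ P₄ ∷ P₉ ∷ P₁₀ ∷ P₆ ∷ []
boundary P₆  = P₁ ∷ P₅ ∷ P₁₀ ∷ P₁₁ ∷ P₂ ∷ []
boundary P₇  = P₁₂ ∷ P₈ ∷ P₃ ∷ P₂ ∷ P₁₁ ∷ []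
boundary P₈  = P₁₂ ∷ P₉ ∷ P₄ ∷ P₃ ∷ P₇ ∷ []
boundary P₉  = P₁₂ ∷ P₁₀ ∷ P₅ ∷ P₄ ∷ P₈ ∷ []
boundary P₁₀ = P₁₂ ∷ P₁₁ ∷ P₆ ∷ P₅ ∷ P₉ ∷ []
boundary P₁₁ = P₁₂ ∷ P₇ ∷ P₂ ∷ P₆ ∷ P₁₀ ∷ []
boundary P₁₂ = P₇ ∷ P₁₁ ∷ P₁₀ ∷ P₉ ∷ P₈ ∷ []

infix 4 _~_

_~_ : Tile → Tile → Set
i ~ j = j ∈ boundary i

-- An edge together with the choice of one of its two sides: (i , j , _) and
-- (j , i , _) are the same edge of the tiling.  The identification is imposed
-- by the field `glued` of `EdgeLengths`.
Edge : Set
Edge = ∃₂ _~_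

E : (i j : Tile) {i~j : True (j ∈? boundary i)} → Edge
E i j {i~j} = i , j , toWitness i~j

Side : Set
Side = Fin 5

nextSide : Side → Side
nextSide s = suc (toℕ s) mod 5

AdjacentSides : Side → Side → Set
AdjacentSides s t = t ≡ nextSide s ⊎ s ≡ nextSide t

neighbour : Tile → Side → Tile
neighbour i s = lookup (boundary i) s

edge : Tile → Side → Edge
edge i s = i , neighbour i s , ∈-lookup s (boundary i)

-- The tiles i, j, k share a vertex: the edges that i has in common with
-- j and with k are adjacent on the boundary of i.
Vertex : Tile → Tile → Tile → Set
Vertex i j k =
  ∃₂ λ s t → AdjacentSides s t × neighbour i s ≡ j × neighbour i t ≡ k

-- Since the pattern is finite, a bijection on tiles that preserves edges and
-- vertices also reflects them.  Orientation-reversing symmetries are included.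
record Symmetry : Set where
  field
    perm             : Permutation′ 12
    preserves-edge   : ∀ {i j} → i ~ j → (perm ⟨$⟩ʳ i) ~ (perm ⟨$⟩ʳ j)
    preserves-vertex : ∀ {i j k} → Vertex i j k →
                       Vertex (perm ⟨$⟩ʳ i) (perm ⟨$⟩ʳ j) (perm ⟨$⟩ʳ k)

  onEdge : Edge → Edge
  onEdge (i , j , i~j) = perm ⟨$⟩ʳ i , perm ⟨$⟩ʳ j , preserves-edge i~j

-- Lengths are only ever compared for equality, so L is an arbitrary set.
record EdgeLengths (L : Set ℓ) : Set ℓ where
  field
    length : Edge → L
    glued  : ∀ {i j} (i~j : i ~ j) (j~i : j ~ i) →
             length (i , j , i~j) ≡ length (j , i , j~i)

  sideLength : Tile → Side → L
  sideLength i s = length (edge i s)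

open EdgeLengths

CongruentTiles : {L : Set ℓ} → EdgeLengths L → Tile → Tile → Set ℓ
CongruentTiles T i j =
  Σ[ π ∈ Permutation′ 5 ]
    (∀ s t → AdjacentSides s t → AdjacentSides (π ⟨$⟩ʳ s) (π ⟨$⟩ʳ t)) ×
    (∀ s → sideLength T i s ≡ sideLength T j (π ⟨$⟩ʳ s))

EdgeCongruent : {L : Set ℓ} → EdgeLengths L → Set ℓ
EdgeCongruent T = ∀ i j → CongruentTiles T i j

-- Equality of multisets: the cyclic arrangement of the lengths is not prescribed.
TilesHaveLengths : {L : Set ℓ} → EdgeLengths L → List L → Set ℓ
TilesHaveLengths T ls = ∀ i → toList (tabulate (sideLength T i)) ↭ ls

aEdges bEdges cEdges : List Edge
aEdges =
  E P₁ P₃ ∷ E P₁ P₄  ∷ E P₃ P₄  ∷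
  E P₂ P₇ ∷ E P₂ P₁₁ ∷ E P₇ P₁₁ ∷
  E P₅ P₆ ∷ E P₅ P₁₀ ∷ E P₆ P₁₀ ∷
  E P₈ P₉ ∷ E P₈ P₁₂ ∷ E P₉ P₁₂ ∷ []
bEdges =
  E P₁ P₂   ∷ E P₁ P₆   ∷ E P₂ P₆   ∷
  E P₃ P₇   ∷ E P₃ P₈   ∷ E P₇ P₈   ∷
  E P₄ P₅   ∷ E P₄ P₉   ∷ E P₅ P₉   ∷
  E P₁₀ P₁₁ ∷ E P₁₀ P₁₂ ∷ E P₁₁ P₁₂ ∷ []
cEdges =
  E P₁ P₅ ∷ E P₂ P₃ ∷ E P₄ P₈ ∷ E P₆ P₁₁ ∷ E P₇ P₁₂ ∷ E P₉ P₁₀ ∷ []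

-- T is the image under σ of the assignment with lengths a, b, c on
-- aEdges, bEdges, cEdges; these lists contain each of the 30 edges once.
IsStandard : {L : Set ℓ} → EdgeLengths L → Symmetry → (a b c : L) → Set ℓ
IsStandard T σ a b c =
  All (λ e → length T (Symmetry.onEdge σ e) ≡ a) aEdges ×
  All (λ e → length T (Symmetry.onEdge σ e) ≡ b) bEdges ×
  All (λ e → length T (Symmetry.onEdge σ e) ≡ c) cEdges

-- Read off from every tile the word of its five lengths.  Congruence puts all
-- words into one of the four cyclic arrangements of a, a, b, b, c, which are told
-- apart by whether the two a's and whether the two b's are adjacent.  A
-- backtracking search over the tiles, matching lengths along shared edges, leaves
-- only the arrangement in which both are adjacent, realised in exactly ten ways:
-- the standard assignment and its a ↔ b swap, each rotated about a fixed tile.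
-- Conversely, every tile of the standard assignment reads a, a, b, b, c up to
-- rotation and reflection, and a symmetry induces an adjacency-preserving
-- bijection from the sides of a tile to the sides of its image.

module Submission where

open import Defs
open import Data.Bool as Bool using (Bool; true; false)
open import Data.Fin using (Fin; zero; suc; punchIn; punchOut; _≟_)
open import Data.Fin.Permutation as Perm
  using (Permutation′; _⟨$⟩ʳ_; _⟨$⟩ˡ_; _∘ₚ_; permutation; remove)
open import Data.Fin.Properties
  using (all?; any?; injective⇒≤; punchOut-injective)
open import Data.List using (List; _∷_; []; cartesianProductWith; filter; length)
import Data.List as List
open import Data.List.Membership.Propositional using () renaming (_∈_ to _∈ₗ_)
open import Data.List.Membership.Propositional.Properties
  using (∈-filter⁺; ∈-cartesianProductWith⁺; ∈-allFin)
open import Data.List.Properties using (∷-injective)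
open import Data.List.Relation.Binary.Permutation.Propositional
  using (_↭_; prep; swap; ↭-refl; ↭-sym; ↭-trans; ↭-reflexive)
open import Data.List.Relation.Binary.Permutation.Propositional.Properties
  using (filter-↭; shifts; ↭-length; ↭-map-inv)
open import Data.List.Relation.Unary.All as All using (All)
open import Data.List.Relation.Unary.Any as Any using (Any; here)
open import Data.Nat as ℕ using (ℕ; suc)
open import Data.Nat.Properties using (1+n≰n)
open import Data.Product
  using (Σ-syntax; _×_; ∃-syntax; ∃₂; _,_; proj₁; proj₂)
open import Data.Product.Properties using (≡-dec)
open import Data.Sum as Sum using (_⊎_; inj₁; inj₂; [_,_]′)
open import Data.Vec using (Vec; _∷_; []; lookup; tabulate; toList; allFin; map)
open import Data.Vec.Membership.DecPropositional {A = Fin 12} _≟_ using (_∈?_)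
open import Data.Vec.Membership.Propositional using (_∈_)
open import Data.Vec.Membership.Propositional.Properties using (∈-lookup)
open import Data.Vec.Properties using (tabulate-cong; lookup-map; lookup-allFin)
open import Data.Vec.Relation.Binary.Pointwise.Inductive as Pointwise
  using (Pointwise; []; _∷_)
import Data.Vec.Relation.Unary.Any as VecAny
open import Data.Vec.Relation.Unary.Any.Properties using (lookup-index)
open import Function using (_∘_; id; Injective)
open import Function.Bundles using (Injection; _⇔_; mk⇔)
open import Function.Properties.Inverse using (↔⇒↣)
open import Level using (Level)
open import Relation.Binary.PropositionalEquality
  using (_≡_; _≢_; _≗_; refl; sym; trans; cong; cong₂; subst; subst₂)
open import Relation.Nullary using (Dec; does; yes; no; contradiction)
open import Relation.Nullary.Decidable
  using (from-yes; does-⇔; ¬?; _×-dec_; _⊎-dec_; _→-dec_)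
open import Relation.Unary using (Decidable)

open EdgeLengths using (glued; sideLength)
open Symmetry

private
  variable
    ℓ : Level
    A L : Set ℓ
    n : ℕ

-- Finite families, their rearrangements and permutations

∷-tabulate-punchIn-↭ : (f : Fin (suc n) → A) (k : Fin (suc n)) →
  f k ∷ toList (tabulate (f ∘ punchIn k)) ↭ toList (tabulate f)
∷-tabulate-punchIn-↭ f zero = ↭-refl
∷-tabulate-punchIn-↭ {suc n} f (suc k) =
  ↭-trans (swap _ _ ↭-refl) (prep _ (∷-tabulate-punchIn-↭ (f ∘ suc) k))

tabulate-cong-↭ : {f g : Fin n → A} → f ≗ g → toList (tabulate f) ↭ toList (tabulate g)
tabulate-cong-↭ = ↭-reflexive ∘ cong toList ∘ tabulate-cong

-- Once the value at `π ⟨$⟩ʳ zero` is split off, `remove zero π` permutes the remaining indices and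
-- induction applies.
tabulate-permute-↭ : (f : Fin n → A) (π : Permutation′ n) →
  toList (tabulate (f ∘ (π ⟨$⟩ʳ_))) ↭ toList (tabulate f)
tabulate-permute-↭ {ℕ.zero} f π = ↭-refl
tabulate-permute-↭ {suc n} f π = ↭-trans
  (prep _ (↭-trans
    (tabulate-cong-↭ (λ j → cong f (Perm.punchIn-permute π zero j)))
    (tabulate-permute-↭ (f ∘ punchIn (π ⟨$⟩ʳ zero)) (remove zero π))))
  (∷-tabulate-punchIn-↭ f (π ⟨$⟩ʳ zero))

tabulate≡map⁻ : {B : Set} (g : B → A) (f : Fin n → A) {ys : List B} →
  toList (tabulate f) ≡ List.map g ys →
  Σ[ w ∈ Vec B n ] toList w ≡ ys × (∀ s → f s ≡ g (lookup w s))
tabulate≡map⁻ {n = ℕ.zero} g f {[]} _ = [] , refl , λ ()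
tabulate≡map⁻ {n = suc n} g f {y ∷ ys} eq
  with fz≡gy , rest ← ∷-injective eq
  with w , refl , f≗g ← tabulate≡map⁻ g (f ∘ suc) rest
  = y ∷ w , refl , λ { zero → fz≡gy ; (suc s) → f≗g s }

permutation-injective : (π : Permutation′ n) → Injective _≡_ _≡_ (π ⟨$⟩ʳ_)
permutation-injective π = Injection.injective (↔⇒↣ π)

-- Pigeonhole: if some `t` were missed, punching it out would inject `Fin (suc n)` into `Fin n`. So
-- `f` is onto, and chosen preimages form the inverse.
injective⇒permutation : (f : Fin n → Fin n) → Injective _≡_ _≡_ f →
  Σ[ π ∈ Permutation′ n ] (∀ s → π ⟨$⟩ʳ s ≡ f s)
injective⇒permutation {ℕ.zero} f inj = Perm.id , λ ()
injective⇒permutation {suc n} f inj =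
  permutation f (proj₁ ∘ surj) (proj₂ ∘ surj) (inj ∘ proj₂ ∘ surj ∘ f) , λ _ → refl
  where
  surj : ∀ t → ∃[ s ] f s ≡ t
  surj t with any? (λ s → f s ≟ t)
  ... | yes hit = hit
  ... | no ¬hit = contradiction (injective⇒≤ avoid-injective) 1+n≰n
    where
    t≢f : ∀ s → t ≢ f s
    t≢f s t≡fs = ¬hit (s , sym t≡fs)
    avoid-injective : Injective _≡_ _≡_ (λ s → punchOut (t≢f s))
    avoid-injective {x} {y} = inj ∘ punchOut-injective (t≢f x) (t≢f y)

-- Enumeration of words and backtracking search

words : ∀ k n → List (Vec (Fin k) n)
words k ℕ.zero  = [] ∷ []
words k (suc n) = cartesianProductWith _∷_ (List.allFin k) (words k n)

∈-words : ∀ {k} (w : Vec (Fin k) n) → w ∈ₗ words k n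
∈-words []      = here refl
∈-words (x ∷ w) = ∈-cartesianProductWith⁺ _∷_ (∈-allFin x) (∈-words w)

module Backtracking {I W : Set} {_≈_ : I × W → I × W → Set}
  (_≈?_ : ∀ x y → Dec (x ≈ y)) where

  -- Only the head is compared with the later entries; those were compared with each other when
  -- `solutions` built the tail.
  Consistent : Vec I (suc n) → Vec W (suc n) → Set
  Consistent (i ∷ is) (w ∷ ws) = Pointwise (λ j v → (i , w) ≈ (j , v)) is ws

  consistent? : (is : Vec I (suc n)) → Decidable (Consistent is)
  consistent? (i ∷ is) (w ∷ ws) =
    Pointwise.decidable (λ j v → (i , w) ≈? (j , v)) is ws

  solutions : List W → Vec I n → List (Vec W n)
  solutions candidates []       = [] ∷ []
  solutions candidates (i ∷ is) = filter (consistent? (i ∷ is))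
    (cartesianProductWith _∷_ candidates (solutions candidates is))

  -- Completeness of the search: the restrictions of a globally compatible `f` pass the filter at
  -- every level.
  ∈-solutions : ∀ {candidates} (f : I → W) → (∀ i → f i ∈ₗ candidates) →
    (∀ i j → (i , f i) ≈ (j , f j)) →
    (is : Vec I n) → map f is ∈ₗ solutions candidates is
  ∈-solutions f f∈ compatible []       = here refl
  ∈-solutions f f∈ compatible (i ∷ is) =
    ∈-filter⁺ (consistent? (i ∷ is))
      (∈-cartesianProductWith⁺ _∷_ (f∈ i) (∈-solutions f f∈ compatible is))
      (pointwise is)
    where
    pointwise : (js : Vec _ n) → Pointwise (λ j v → (i , f i) ≈ (j , v)) js (map f js)
    pointwise []       = []
    pointwise (j ∷ js) = compatible i j ∷ pointwise js

-- Congruence of pentagons as an equivalence relation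

adjacent? : ∀ s t → Dec (AdjacentSides s t)
adjacent? s t = (t ≟ nextSide s) ⊎-dec (s ≟ nextSide t)

PreservesAdjacency : Permutation′ 5 → Set
PreservesAdjacency π = ∀ s t → AdjacentSides s t → AdjacentSides (π ⟨$⟩ʳ s) (π ⟨$⟩ʳ t)

infix 4 _≅_

_≅_ : {L : Set ℓ} → (Side → L) → (Side → L) → Set ℓ
f ≅ g = Σ[ π ∈ Permutation′ 5 ] PreservesAdjacency π × (∀ s → f s ≡ g (π ⟨$⟩ʳ s))

abstract
  adjacent-exhaustive : ∀ s t x y → AdjacentSides s x → AdjacentSides s y → x ≢ y →
    AdjacentSides s t → t ≡ x ⊎ t ≡ y
  adjacent-exhaustive = from-yes (all? λ s → all? λ t → all? λ x → all? λ y →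
    adjacent? s x →-dec adjacent? s y →-dec (¬? (x ≟ y)) →-dec
    adjacent? s t →-dec ((t ≟ x) ⊎-dec (t ≟ y)))

  two-neighbours : ∀ s → ∃₂ λ x y → AdjacentSides s x × AdjacentSides s y × x ≢ y
  two-neighbours = from-yes (all? λ s → any? λ x → any? λ y →
    adjacent? s x ×-dec adjacent? s y ×-dec ¬? (x ≟ y))

-- A side has only two neighbours, so preserving adjacency implies reflecting it.
flip-preserves : ∀ π → PreservesAdjacency π → PreservesAdjacency (Perm.flip π)
flip-preserves π adj s t s~t with two-neighbours (π ⟨$⟩ˡ s)
... | x , y , u~x , u~y , x≢y =
  Sum.[ reflect u~x , reflect u~y ]
    (adjacent-exhaustive s t (π ⟨$⟩ʳ x) (π ⟨$⟩ʳ y)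
      (forward u~x) (forward u~y) (x≢y ∘ permutation-injective π) s~t)
  where
  forward : ∀ {x} → AdjacentSides (π ⟨$⟩ˡ s) x → AdjacentSides s (π ⟨$⟩ʳ x)
  forward {x} = subst (λ v → AdjacentSides v (π ⟨$⟩ʳ x)) (Perm.inverseʳ π) ∘ adj _ _
  reflect : ∀ {x} → AdjacentSides (π ⟨$⟩ˡ s) x → t ≡ π ⟨$⟩ʳ x →
            AdjacentSides (π ⟨$⟩ˡ s) (π ⟨$⟩ˡ t)
  reflect u~x t≡πx = subst (AdjacentSides _)
    (sym (trans (cong (π ⟨$⟩ˡ_) t≡πx) (Perm.inverseˡ π))) u~x

≅-sym : (f g : Side → L) → f ≅ g → g ≅ f
≅-sym f g (π , adj , f≗gπ) = Perm.flip π , flip-preserves π adj ,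
  λ s → trans (cong g (sym (Perm.inverseʳ π))) (sym (f≗gπ (π ⟨$⟩ˡ s)))

≅-trans : (f g h : Side → L) → f ≅ g → g ≅ h → f ≅ h
≅-trans f g h (π , adjπ , f≗gπ) (ρ , adjρ , g≗hρ) =
  π ∘ₚ ρ , (λ s t → adjρ _ _ ∘ adjπ s t) , λ s → trans (f≗gπ s) (g≗hρ (π ⟨$⟩ʳ s))

≅⇒↭ : (f g : Side → L) → f ≅ g → toList (tabulate f) ↭ toList (tabulate g)
≅⇒↭ f g (π , _ , f≗gπ) =
  ↭-trans (tabulate-cong-↭ f≗gπ) (tabulate-permute-↭ g π)

-- Edges of the dodecahedral pattern and their lengths

abstract
  neighbour-injective : ∀ i s t → neighbour i s ≡ neighbour i t → s ≡ t
  neighbour-injective = from-yes (all? λ i → all? λ s → all? λ t →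
    (neighbour i s ≟ neighbour i t) →-dec (s ≟ t))

  neighbour-sym : ∀ i s → neighbour i s ~ i
  neighbour-sym = from-yes (all? λ i → all? λ s → i ∈? boundary (neighbour i s))

~-sym : ∀ {i j} → i ~ j → j ~ i
~-sym {i} i~j = subst (λ j → i ∈ boundary j) (sym (lookup-index i~j)) (neighbour-sym i _)

SameEdge : Edge → Edge → Set
SameEdge (i , j , _) (k , l , _) = (i ≡ k × j ≡ l) ⊎ (i ≡ l × j ≡ k)

sameEdge? : ∀ e e′ → Dec (SameEdge e e′)
sameEdge? (i , j , _) (k , l , _) =
  ((i ≟ k) ×-dec (j ≟ l)) ⊎-dec ((i ≟ l) ×-dec (j ≟ k))

module _ {L : Set ℓ} (T : EdgeLengths L) where
  open EdgeLengths T using () renaming (length to len)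

  -- `glued` equates both lengths with the length of the same edge seen from its other side.
  length-irrelevant : ∀ {i j} (p q : i ~ j) → len (i , j , p) ≡ len (i , j , q)
  length-irrelevant p q = trans (glued T p (~-sym p)) (sym (glued T q (~-sym p)))

  length≡sideLength : ∀ {i j} (p : i ~ j) s → neighbour i s ≡ j →
                      len (i , j , p) ≡ sideLength T i s
  length≡sideLength p s refl = length-irrelevant p (∈-lookup s _)

  sameEdge⇒≡ : ∀ {e e′} → SameEdge e e′ → len e ≡ len e′
  sameEdge⇒≡ (inj₁ (refl , refl)) = length-irrelevant _ _
  sameEdge⇒≡ (inj₂ (refl , refl)) = glued T _ _

-- Transport of lengths along a symmetry of the pattern

pullback : EdgeLengths L → Symmetry → EdgeLengths L
pullback T σ = record
  { length = EdgeLengths.length T ∘ onEdge σ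
  ; glued  = λ _ _ → glued T _ _
  }

module _ (σ : Symmetry) (i : Tile) where
  private
    σᵗ : Tile → Tile
    σᵗ = perm σ ⟨$⟩ʳ_

    image : ∀ s → σᵗ i ~ σᵗ (neighbour i s)
    image s = preserves-edge σ (∈-lookup s (boundary i))

    φ : Side → Side
    φ s = VecAny.index (image s)

    neighbour-φ : ∀ s → neighbour (σᵗ i) (φ s) ≡ σᵗ (neighbour i s)
    neighbour-φ s = sym (lookup-index (image s))

    φ-unique : ∀ {s t} → neighbour (σᵗ i) t ≡ σᵗ (neighbour i s) → t ≡ φ s
    φ-unique {s} eq = neighbour-injective (σᵗ i) _ _ (trans eq (sym (neighbour-φ s)))

    φ-injective : Injective _≡_ _≡_ φ
    φ-injective {s} {t} eq = neighbour-injective i s t (permutation-injective (perm σ)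
      (trans (sym (neighbour-φ s)) (trans (cong (neighbour (σᵗ i)) eq) (neighbour-φ t))))

    -- `preserves-vertex` yields some adjacent sides `s′`, `t′` of the image tile facing the right
    -- neighbours. A tile meets each neighbour along one side only, so these sides are `φ s` and
    -- `φ t`.
    φ-adjacent : ∀ s t → AdjacentSides s t → AdjacentSides (φ s) (φ t)
    φ-adjacent s t s~t with preserves-vertex σ (s , t , s~t , refl , refl)
    ... | s′ , t′ , s′~t′ , s′↦ , t′↦ =
      subst₂ AdjacentSides (φ-unique s′↦) (φ-unique t′↦) s′~t′

  pullback-≅ : (T : EdgeLengths L) → sideLength (pullback T σ) i ≅ sideLength T (σᵗ i)
  pullback-≅ T = let π , π≗φ = injective⇒permutation φ φ-injective in
    π ,
    (λ s t → subst₂ AdjacentSides (sym (π≗φ s)) (sym (π≗φ t)) ∘ φ-adjacent s t) ,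
    (λ s → trans (length≡sideLength T (image s) (φ s) (neighbour-φ s))
                 (cong (sideLength T (σᵗ i)) (sym (π≗φ s))))

-- Shape of the tiles in the standard assignment

Letter : Set
Letter = Fin 3

pattern α = zero
pattern β = suc α
pattern γ = suc β

Word : Set
Word = Vec Letter 5

ααββγ : Word
ααββγ = α ∷ α ∷ β ∷ β ∷ γ ∷ []

edgesOf : Letter → List Edge
edgesOf α = aEdges
edgesOf β = bEdges
edgesOf γ = cEdges

Follows : {L : Set ℓ} → (Edge → L) → (a b c : L) → Set ℓ
Follows len a b c =
  All (λ e → len e ≡ a) aEdges ×
  All (λ e → len e ≡ b) bEdges ×
  All (λ e → len e ≡ c) cEdges

turn : Permutation′ 5
turn = permutation nextSide (nextSide ∘ nextSide ∘ nextSide ∘ nextSide) turn⁵ turn⁵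
  where
  turn⁵ : ∀ s → nextSide (nextSide (nextSide (nextSide (nextSide s)))) ≡ s
  turn⁵ = from-yes (all? λ s → nextSide (nextSide (nextSide (nextSide (nextSide s)))) ≟ s)

-- The ten symmetries of the pentagon, listed so that a search for a correspondence of sides stays
-- short.
dihedral : List (Permutation′ 5)
dihedral = cartesianProductWith _∘ₚ_
  (Perm.id ∷ Perm.reverse ∷ []) (List.iterate (turn ∘ₚ_) Perm.id 5)

abstract
  -- Settled by trying the ten dihedral moves on each tile. `SameEdge` is used because the edge
  -- lists name each edge from one side only.
  standard-layout : ∀ i → Any (λ π → PreservesAdjacency π ×
    (∀ s → Any (SameEdge (edge i s)) (edgesOf (lookup ααββγ (π ⟨$⟩ʳ s))))) dihedral
  standard-layout = from-yes (all? λ i → Any.any? (λ π →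
    (all? λ s → all? λ t → adjacent? s t →-dec adjacent? (π ⟨$⟩ʳ s) (π ⟨$⟩ʳ t)) ×-dec
    (all? λ s → Any.any? (sameEdge? (edge i s)) (edgesOf (lookup ααββγ (π ⟨$⟩ʳ s))))) dihedral)

module _ (a b c : L) where

  ⟦_⟧ : Letter → L
  ⟦_⟧ = lookup (a ∷ b ∷ c ∷ [])

  -- Here the distinctness of the three lengths enters; it turns equations between lengths into
  -- equations between letters.
  ⟦⟧-injective : a ≢ b → b ≢ c → a ≢ c → ∀ x y → ⟦ x ⟧ ≡ ⟦ y ⟧ → x ≡ y
  ⟦⟧-injective a≢b b≢c a≢c α α _  = refl
  ⟦⟧-injective a≢b b≢c a≢c α β eq = contradiction eq a≢b
  ⟦⟧-injective a≢b b≢c a≢c α γ eq = contradiction eq a≢c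
  ⟦⟧-injective a≢b b≢c a≢c β α eq = contradiction (sym eq) a≢b
  ⟦⟧-injective a≢b b≢c a≢c β β _  = refl
  ⟦⟧-injective a≢b b≢c a≢c β γ eq = contradiction eq b≢c
  ⟦⟧-injective a≢b b≢c a≢c γ α eq = contradiction (sym eq) a≢c
  ⟦⟧-injective a≢b b≢c a≢c γ β eq = contradiction (sym eq) b≢c
  ⟦⟧-injective a≢b b≢c a≢c γ γ _  = refl

  follows⇒All : {len : Edge → L} → Follows len a b c →
                ∀ x → All (λ e → len e ≡ ⟦ x ⟧) (edgesOf x)
  follows⇒All (as , bs , cs) α = as
  follows⇒All (as , bs , cs) β = bs
  follows⇒All (as , bs , cs) γ = cs

  follows⇒≅ : (T : EdgeLengths L) → Follows (EdgeLengths.length T) a b c →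
              ∀ i → sideLength T i ≅ lookup (a ∷ a ∷ b ∷ b ∷ c ∷ [])
  follows⇒≅ T follows i with Any.satisfied (standard-layout i)
  ... | π , adj , same = π , adj , λ s →
    let t             = π ⟨$⟩ʳ s
        len≡ , sameᵉ  = All.lookupAny (follows⇒All follows (lookup ααββγ t)) (same s)
    in trans (sameEdge⇒≡ T sameᵉ) (trans len≡ (sym (lookup-map t ⟦_⟧ ααββγ)))

  standard⇒congruent : ∀ T σ → IsStandard T σ a b c →
    EdgeCongruent T × TilesHaveLengths T (a ∷ a ∷ b ∷ b ∷ c ∷ [])
  standard⇒congruent T σ standard =
    (λ i j → ≅-trans (side i) shape (side j) (side≅ i) (≅-sym (side j) shape (side≅ j))) ,
    (λ i → ≅⇒↭ (side i) shape (side≅ i))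
    where
    side : Tile → Side → L
    side = sideLength T

    shape : Side → L
    shape = lookup (a ∷ a ∷ b ∷ b ∷ c ∷ [])

    image≅ : ∀ i → side (perm σ ⟨$⟩ʳ i) ≅ shape
    image≅ i = ≅-trans (side (perm σ ⟨$⟩ʳ i)) (sideLength (pullback T σ) i) shape
      (≅-sym (sideLength (pullback T σ) i) (side (perm σ ⟨$⟩ʳ i)) (pullback-≅ σ i T))
      (follows⇒≅ (pullback T σ) standard i)

    side≅ : ∀ j → side j ≅ shape
    -- Every tile is the image under `σ` of some tile, so `image≅` reaches all of them.
    side≅ j = subst (λ j → side j ≅ shape) (Perm.inverseʳ (perm σ)) (image≅ (perm σ ⟨$⟩ˡ j))

-- Five-fold rotations of the pattern

id-symmetry : Symmetry
id-symmetry = record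
  { perm             = Perm.id
  ; preserves-edge   = id
  ; preserves-vertex = id
  }

infixr 9 _∘ˢ_

_∘ˢ_ : Symmetry → Symmetry → Symmetry
σ ∘ˢ τ = record
  { perm             = perm τ ∘ₚ perm σ
  ; preserves-edge   = preserves-edge σ ∘ preserves-edge τ
  ; preserves-vertex = preserves-vertex σ ∘ preserves-vertex τ
  }

-- The rotation of order 5 about the centre of P₁.
rotation : Symmetry
rotation = record
  { perm             = permutation ρ (ρ ∘ ρ ∘ ρ ∘ ρ) ρ⁵ ρ⁵
  ; preserves-edge   = λ {i} i~j →
      subst (λ j → ρ i ~ ρ j) (sym (lookup-index i~j)) (ρ-edge i (VecAny.index i~j))
  ; preserves-vertex = λ { {i} (s , t , s~t , refl , refl) → ρ-vertex i s t s~t }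
  }
  where
  ρ : Tile → Tile
  ρ = lookup (P₁ ∷ P₃ ∷ P₄ ∷ P₅ ∷ P₆ ∷ P₂ ∷ P₈ ∷ P₉ ∷ P₁₀ ∷ P₁₁ ∷ P₇ ∷ P₁₂ ∷ [])
  ρ⁵ : ∀ i → ρ (ρ (ρ (ρ (ρ i)))) ≡ i
  ρ⁵ = from-yes (all? λ i → ρ (ρ (ρ (ρ (ρ i)))) ≟ i)
  ρ-edge : ∀ i s → ρ i ~ ρ (neighbour i s)
  ρ-edge = from-yes (all? λ i → all? λ s → ρ (neighbour i s) ∈? boundary (ρ i))
  ρ-vertex : ∀ i s t → AdjacentSides s t →
             Vertex (ρ i) (ρ (neighbour i s)) (ρ (neighbour i t))
  ρ-vertex = from-yes (all? λ i → all? λ s → all? λ t →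
    adjacent? s t →-dec any? λ s′ → any? λ t′ → adjacent? s′ t′ ×-dec
      ((neighbour (ρ i) s′ ≟ ρ (neighbour i s)) ×-dec
       (neighbour (ρ i) t′ ≟ ρ (neighbour i t))))

rotations : List Symmetry
rotations = List.iterate (rotation ∘ˢ_) id-symmetry 5

-- An invariant of cyclic arrangements

Repeats : Letter → (Side → Letter) → Set
Repeats x f = ∃[ s ] (f s ≡ x × f (nextSide s) ≡ x)

repeats? : ∀ x f → Dec (Repeats x f)
repeats? x f = any? λ s → (f s ≟ x) ×-dec (f (nextSide s) ≟ x)

repeats-resp-≅ : ∀ x f g → f ≅ g → Repeats x f → Repeats x g
repeats-resp-≅ x f g (π , adj , f≗gπ) (s , fs≡x , fs′≡x) =
  -- A correspondence may reverse orientation, so the images of `s` and `s′` are consecutive in one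
  -- of two orders; the earlier one is the witness.
  [ (λ πs′≡ → π ⟨$⟩ʳ s  , gπs≡x  , trans (cong g (sym πs′≡)) gπs′≡x)
  , (λ πs≡  → π ⟨$⟩ʳ s′ , gπs′≡x , trans (cong g (sym πs≡)) gπs≡x)
  ]′ (adj s s′ (inj₁ refl))
  where
  s′ = nextSide s
  gπs≡x : g (π ⟨$⟩ʳ s) ≡ x
  gπs≡x = trans (sym (f≗gπ s)) fs≡x
  gπs′≡x : g (π ⟨$⟩ʳ s′) ≡ x
  gπs′≡x = trans (sym (f≗gπ s′)) fs′≡x

-- Distinguishes the four cyclic arrangements of α, α, β, β, γ up to rotation
-- and reflection.
signature : Word → Bool × Bool
signature w = does (repeats? α (lookup w)) , does (repeats? β (lookup w))

does-repeats-≅ : ∀ x f g → f ≅ g → does (repeats? x f) ≡ does (repeats? x g)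
does-repeats-≅ x f g f≅g = does-⇔
  (mk⇔ (repeats-resp-≅ x f g f≅g) (repeats-resp-≅ x g f (≅-sym f g f≅g)))
  (repeats? x f) (repeats? x g)

signature-cong : ∀ w v → lookup w ≅ lookup v → signature w ≡ signature v
signature-cong w v w≅v = cong₂ _,_
  (does-repeats-≅ α (lookup w) (lookup v) w≅v) (does-repeats-≅ β (lookup w) (lookup v) w≅v)

-- Exhaustive search for the colourings

infix 4 _⋈_ _⋈?_

-- Vacuous unless the two tiles share an edge, so it can be demanded of all pairs in the search.
_⋈_ : Tile × Word → Tile × Word → Set
(i , w) ⋈ (j , v) =
  ∀ s t → neighbour i s ≡ j → neighbour j t ≡ i → lookup w s ≡ lookup v t

_⋈?_ : ∀ p q → Dec (p ⋈ q)
(i , w) ⋈? (j , v) =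
  all? λ s → all? λ t → (neighbour i s ≟ j) →-dec (neighbour j t ≟ i) →-dec
    (lookup w s ≟ lookup v t)

open Backtracking _⋈?_

-- Letter counts serve as a decidable form of being a rearrangement of `ααββγ`.
Balanced : Word → Set
Balanced w = ∀ x →
  length (filter (x ≟_) (toList w)) ≡ length (filter (x ≟_) (toList ααββγ))

↭⇒balanced : ∀ w → toList w ↭ toList ααββγ → Balanced w
↭⇒balanced w w↭ x = ↭-length (filter-↭ (x ≟_) w↭)

Candidate : Bool × Bool → Word → Set
Candidate sig w = Balanced w × signature w ≡ sig

candidate? : ∀ sig → Decidable (Candidate sig)
candidate? sig w =
  (all? λ x → length (filter (x ≟_) (toList w)) ℕ.≟
              length (filter (x ≟_) (toList ααββγ))) ×-dec
  (≡-dec Bool._≟_ Bool._≟_ (signature w) sig)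

colourings : Bool × Bool → List (Vec Word 12)
colourings sig = solutions (filter (candidate? sig) (words 3 5)) (allFin 12)

letterOf : Vec Word 12 → Edge → Letter
letterOf ws (i , j , i~j) = lookup (lookup ws i) (VecAny.index i~j)

follows? : ∀ (len : Edge → Letter) x y z → Dec (Follows len x y z)
follows? len x y z =
  All.all? (λ e → len e ≟ x) aEdges ×-dec
  All.all? (λ e → len e ≟ y) bEdges ×-dec
  All.all? (λ e → len e ≟ z) cEdges

-- Five rotations about `P₁`, each with or without exchanging `α` and `β`, account for all ten
-- colourings that the search finds.
StandardColouring : Vec Word 12 → Set
StandardColouring ws = Any (λ σ →
    Follows (letterOf ws ∘ onEdge σ) α β γ ⊎ Follows (letterOf ws ∘ onEdge σ) β α γ)
  rotations

standardColouring? : Decidable StandardColouring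
standardColouring? ws = Any.any? (λ σ →
    follows? (letterOf ws ∘ onEdge σ) α β γ ⊎-dec follows? (letterOf ws ∘ onEdge σ) β α γ)
  rotations

abstract
  -- Splitting on the signature makes each search a closed computation. Only `(true , true)` admits
  -- colourings; for the other signatures the list is empty.
  colourings-standard : ∀ sig → All StandardColouring (colourings sig)
  colourings-standard sig@(true  , true)  =
    from-yes (All.all? standardColouring? (colourings sig))
  colourings-standard sig@(true  , false) =
    from-yes (All.all? standardColouring? (colourings sig))
  colourings-standard sig@(false , true)  =
    from-yes (All.all? standardColouring? (colourings sig))
  colourings-standard sig@(false , false) =
    from-yes (All.all? standardColouring? (colourings sig))

-- From an edge congruent tiling to a standard assignment

module _ {a b c : L} (a≢b : a ≢ b) (b≢c : b ≢ c) (a≢c : a ≢ c) (T : EdgeLengths L)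
  (congruent : EdgeCongruent T)
  (lengths : TilesHaveLengths T (a ∷ a ∷ b ∷ b ∷ c ∷ [])) where

  private
    val : Letter → L
    val = ⟦_⟧ a b c

    val-injective : ∀ {x y} → val x ≡ val y → x ≡ y
    val-injective = ⟦⟧-injective a b c a≢b b≢c a≢c _ _

    word-of : ∀ i → Σ[ w ∈ Word ] (toList w ↭ toList ααββγ) ×
                                  (∀ s → sideLength T i s ≡ val (lookup w s))
    -- The prescribed list of lengths is the image under `val` of the letters of `ααββγ`, so a
    -- rearrangement of it lifts to one of the letters.
    word-of i with ↭-map-inv val {xs = toList ααββγ} (↭-sym (lengths i))
    ... | ys , eq , ααββγ↭ys with tabulate≡map⁻ val (sideLength T i) eq
    ... | w , refl , side≡ = w , ↭-sym ααββγ↭ys , side≡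

    word : Tile → Word
    word i = proj₁ (word-of i)

    sideLength≡ : ∀ i s → sideLength T i s ≡ val (lookup (word i) s)
    sideLength≡ i = proj₂ (proj₂ (word-of i))

    -- By congruence all tiles have the same signature, so `P₁` serves as the reference.
    sig : Bool × Bool
    sig = signature (word P₁)

    word-≅ : ∀ i j → lookup (word i) ≅ lookup (word j)
    word-≅ i j with congruent i j
    ... | π , adj , eq = π , adj , λ s → val-injective
      (trans (sym (sideLength≡ i s)) (trans (eq s) (sideLength≡ j (π ⟨$⟩ʳ s))))

    word-∈ : ∀ i → word i ∈ₗ filter (candidate? sig) (words 3 5)
    word-∈ i = ∈-filter⁺ (candidate? sig) (∈-words (word i))
      (↭⇒balanced (word i) (proj₁ (proj₂ (word-of i))) ,
       signature-cong (word i) (word P₁) (word-≅ i P₁))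

    word-⋈ : ∀ i j → (i , word i) ⋈ (j , word j)
    word-⋈ i j s t is≡j jt≡i = val-injective
      (trans (sym (sideLength≡ i s)) (trans shared (sideLength≡ j t)))
      where
      shared : sideLength T i s ≡ sideLength T j t
      shared = sameEdge⇒≡ T (inj₂ (sym jt≡i , is≡j))

    colouring : Vec Word 12
    colouring = map word (allFin 12)

    length≡ : ∀ e → EdgeLengths.length T e ≡ val (letterOf colouring e)
    length≡ (i , j , i~j) =
      trans (length≡sideLength T i~j s (sym (lookup-index i~j)))
        (trans (sideLength≡ i s) (cong (λ w → val (lookup w s)) (sym lookup-colouring)))
      where
      s = VecAny.index i~j
      lookup-colouring : lookup colouring i ≡ word i
      lookup-colouring = trans (lookup-map i word (allFin 12)) (cong word (lookup-allFin i))

    follows-val : ∀ (f : Edge → Edge) {x y z} → Follows (letterOf colouring ∘ f) x y z →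
                  Follows (EdgeLengths.length T ∘ f) (val x) (val y) (val z)
    follows-val f (xs , ys , zs) = All.map val≡ xs , All.map val≡ ys , All.map val≡ zs
      where
      val≡ : ∀ {e x} → letterOf colouring (f e) ≡ x → EdgeLengths.length T (f e) ≡ val x
      val≡ {e} eq = trans (length≡ (f e)) (cong val eq)

  congruent⇒standard : ∃[ σ ] (IsStandard T σ a b c ⊎ IsStandard T σ b a c)
  congruent⇒standard =
    let σ , standard = Any.satisfied (All.lookup (colourings-standard sig)
                         (∈-solutions word word-∈ word-⋈ (allFin 12)))
    in σ , Sum.map (follows-val (onEdge σ)) (follows-val (onEdge σ)) standard

proposition12 : ∀ {ℓ} {L : Set ℓ} (a b c : L) → a ≢ b → b ≢ c → a ≢ c →
    (T : EdgeLengths L) →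
    (EdgeCongruent T × TilesHaveLengths T (a ∷ a ∷ b ∷ b ∷ c ∷ [])) ⇔
    (∃[ σ ] (IsStandard T σ a b c ⊎ IsStandard T σ b a c))
proposition12 a b c a≢b b≢c a≢c T = mk⇔
  (λ (congruent , lengths) → congruent⇒standard a≢b b≢c a≢c T congruent lengths)
  λ { (σ , inj₁ standard) → standard⇒congruent a b c T σ standard
    ; (σ , inj₂ standard) →
        let congruent , lengths = standard⇒congruent b a c T σ standard
        -- With `a` and `b` exchanged the lengths arrive as `b, b, a, a, c`; moving the block of two
        -- `b`s past the two `a`s restores the order.
        in congruent , λ i → ↭-trans (lengths i) (shifts (b ∷ b ∷ []) (a ∷ a ∷ []))
    }
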